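{- Let $G$ be a connected $(P_7,C_7,C_4,\text{diamond})$-free graph. Then at least one of the following holds: $G$ is the Petersen graph; $G$ has a clique-cutset; $G$ has a vertex of degree at most $\omega(G)$.
   Context: All graphs are finite and simple. $P_\ell$ and $C_\ell$ denote the chordless path and chordless cycle on $\ell$ vertices. The diamond is the complete graph on four vertices minus an edge. A graph is $(L_1,L_2,\ldots)$-free if it has no induced subgraph isomorphic to any $L_i$. A clique-cutset of $G$ is a clique $K$ in $G$ such that $G\setminus K$ has more connected components than $G$. $\omega(G)$ is the size of a largest clique of $G$. -}

module Defs where

open import Level using (0ℓ)
open import Data.Nat using (ℕ; suc; _≤_; _<_; _%_; NonZero)
import Data.Nat as ℕ
open import Data.Fin using (Fin; toℕ; #_)
import Data.Fin.Properties as Fin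
open import Data.Fin.Subset using (Subset; ⊤; ∁; _∈_; ∣_∣)
open import Data.List using (List; []; _∷_)
import Data.List.Membership.Propositional as List
import Data.List.Membership.DecPropositional as DecList
open import Data.Product using (∃-syntax; Σ-syntax; _×_; _,_)
open import Data.Product.Properties using (≡-dec)
open import Data.Sum using (_⊎_; swap)
open import Data.Vec using (tabulate)
open import Function.Base using (_∘_)
open import Function.Bundles using (_⇔_; _↔_; Inverse)
open import Function.Definitions using (Injective)
open import Relation.Binary.Core using (Rel)
open import Relation.Binary.Definitions using (Decidable; Symmetric)
open import Relation.Binary.Construct.Closure.ReflexiveTransitive using (Star)
open import Relation.Binary.PropositionalEquality using (_≡_; _≢_; refl; sym)
open import Relation.Nullary using (¬_)
open import Relation.Nullary.Decidable using (does; _×-dec_; _⊎-dec_; ¬?)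

record Graph (n : ℕ) : Set₁ where
  infix 4 _~_ _~?_
  field
    _~_      : Rel (Fin n) 0ℓ
    _~?_     : Decidable _~_
    ~-sym    : Symmetric _~_
    ~-irrefl : ∀ {v} → ¬ (v ~ v)

-- The simple graph underlying a digraph: orientations and loops are forgotten.
fromArcs : ∀ {n} {R : Rel (Fin n) 0ℓ} → Decidable R → Graph n
fromArcs {R = R} R? = record
  { _~_      = λ u v → u ≢ v × (R u v ⊎ R v u)
  ; _~?_     = λ u v → ¬? (u Fin.≟ v) ×-dec (R? u v ⊎-dec R? v u)
  ; ~-sym    = λ (u≢v , r) → (u≢v ∘ sym) , swap r
  ; ~-irrefl = λ (v≢v , _) → v≢v refl
  }

fromEdges : ∀ {n} → List (Fin n × Fin n) → Graph n
fromEdges es = fromArcs {R = λ u v → (u , v) List.∈ es} λ u v → (u , v) ∈? es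
  where open DecList (≡-dec Fin._≟_ Fin._≟_) using (_∈?_)

P : ∀ ℓ → Graph ℓ
P ℓ = fromArcs λ i j → suc (toℕ i) ℕ.≟ toℕ j

-- This is the cycle of length ℓ only for ℓ ≥ 3.
C : ∀ ℓ → .{{NonZero ℓ}} → Graph ℓ
C ℓ = fromArcs λ i j → suc (toℕ i) % ℓ ℕ.≟ toℕ j

-- All pairs from {0,1,2,3} except {2,3}.
diamond : Graph 4
diamond = fromEdges
  ( (# 0 , # 1) ∷ (# 0 , # 2) ∷ (# 0 , # 3) ∷ (# 1 , # 2) ∷ (# 1 , # 3) ∷ [])

-- Outer 5-cycle on 0..4, spokes i — i+5, inner pentagram on 5..9.
petersen : Graph 10
petersen = fromEdges
  ( (# 0 , # 1) ∷ (# 1 , # 2) ∷ (# 2 , # 3) ∷ (# 3 , # 4) ∷ (# 4 , # 0)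
  ∷ (# 0 , # 5) ∷ (# 1 , # 6) ∷ (# 2 , # 7) ∷ (# 3 , # 8) ∷ (# 4 , # 9)
  ∷ (# 5 , # 7) ∷ (# 7 , # 9) ∷ (# 9 , # 6) ∷ (# 6 , # 8) ∷ (# 8 , # 5)
  ∷ [])

Embeds : ∀ {m n} → Graph m → Graph n → (Fin m → Fin n) → Set
Embeds H G f = ∀ i j → i H.~ j ⇔ f i G.~ f j
  where
  module H = Graph H
  module G = Graph G

infix 4 _≅_

_≅_ : ∀ {m n} → Graph m → Graph n → Set
_≅_ {m} {n} H G = Σ[ f ∈ Fin m ↔ Fin n ] Embeds H G (Inverse.to f)

_-Free : ∀ {m n} → Graph m → Graph n → Set
(H -Free) G = ¬ (∃[ f ] Injective _≡_ _≡_ f × Embeds H G f)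

module _ {n : ℕ} (G : Graph n) where
  open Graph G

  neighbours : Fin n → Subset n
  neighbours v = tabulate λ u → does (v ~? u)

  degree : Fin n → ℕ
  degree v = ∣ neighbours v ∣

  IsClique : Subset n → Set
  IsClique K = ∀ {u v} → u ∈ K → v ∈ K → u ≢ v → u ~ v

  -- w = ω(G)
  IsCliqueNumber : ℕ → Set
  IsCliqueNumber w =
    (∃[ K ] IsClique K × ∣ K ∣ ≡ w) × (∀ K → IsClique K → ∣ K ∣ ≤ w)

  -- For u and v in S: u and v are joined by a path in the subgraph induced by S.
  -- (A vertex outside S is related to itself only.)
  Joined : Subset n → Rel (Fin n) 0ℓ
  Joined S = Star λ u v → u ∈ S × v ∈ S × u ~ v

  -- The subgraph induced by S has exactly k connected components: r picks one
  -- representative vertex from each.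
  HasComponents : Subset n → ℕ → Set
  HasComponents S k = Σ[ r ∈ (Fin k → Fin n) ]
    (∀ i → r i ∈ S) ×
    (∀ i j → Joined S (r i) (r j) → i ≡ j) ×
    (∀ v → v ∈ S → ∃[ i ] Joined S v (r i))

  -- The graph with no vertices is not connected.
  Connected : Set
  Connected = 0 < n × (∀ u v → Joined ⊤ u v)

  IsCliqueCutset : Subset n → Set
  IsCliqueCutset K = IsClique K ×
    (∃[ k ] ∃[ k′ ] HasComponents ⊤ k × HasComponents (∁ K) k′ × k < k′)

{-# OPTIONS --safe #-}
module Submission where

-- Suppose every degree exceeds ω(G).  For an edge xy, diamond-freeness makes
-- {x} ∪ (N(x) ∩ N[y]) a clique, so x has at least two neighbours outside N[y].
-- This property (Expanding) already suffices, without any appeal to clique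
-- cutsets: an edge grows into an induced P₇ unless an induced C₅ or C₆ closes on
-- the way, a C₅ leads to a C₆, a C₆ leads to a Petersen graph, and a further
-- vertex adjacent to the Petersen graph is contradictory, so connectivity
-- leaves G no other vertices.  Each of these steps is a finite case analysis that
-- alternately adds a neighbour provided by Expanding and decides its
-- adjacencies until a known graph occurs.

open import Defs
open import Data.Bool using (Bool; true; false)
import Data.Bool.Properties as Bool
open import Data.Empty using (⊥-elim)
open import Data.Fin using (Fin; zero; suc; toℕ; fromℕ<)
open import Data.Fin.Patterns
import Data.Fin.Properties as Fin
open import Data.Fin.Subset as Subset using (Subset; ⊤; inside; outside; _∈_; ∣_∣; _-_)
import Data.Fin.Subset.Properties as Subset
open import Data.Maybe using (Maybe; just; nothing)
import Data.Maybe.Properties as Maybe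
open import Data.Nat using (ℕ; zero; suc; _≤_; _<_; _≟_; _<?_; _≤?_; z≤n; s≤s; s≤s⁻¹)
import Data.Nat.Properties as ℕ
open import Data.Product using (∃-syntax; Σ-syntax; _×_; _,_; proj₁; proj₂)
open import Data.Sum using (_⊎_; inj₁; inj₂)
open import Data.Vec using (Vec; []; _∷_; lookup; tabulate; there)
import Data.Vec.Properties as Vec
open import Function.Base using (_$_; _∘_; id)
open import Function.Bundles using (mk⇔; mk↔ₛ′; Equivalence)
open import Function.Construct.Composition using (_⇔-∘_)
open import Function.Definitions using (Injective)
open import Relation.Binary.Construct.Closure.ReflexiveTransitive using (ε; _◅_)
open import Relation.Binary.PropositionalEquality
open import Relation.Nullary using (¬_; Dec; yes; no; contradiction)
open import Relation.Nullary.Decidable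
  using (does; True; toWitness; from-yes; map′; dec-true; dec-false; does-⇔; decidable-stable
        ; ¬?; _×-dec_; _⊎-dec_; _→-dec_)
open import Relation.Unary using (Decidable)

-- Induced subgraph containment

does-true : ∀ {P : Set} (P? : Dec P) → does P? ≡ true → P
does-true (yes p) _ = p

does-false : ∀ {P : Set} (P? : Dec P) → does P? ≡ false → ¬ P
does-false (no ¬p) _ = ¬p

-- The witness that `-Free` denies. As a record it lets unification recover `H` and `G`, which the
-- unfolded `Embeds` does not.
record Contains {m n} (H : Graph m) (G : Graph n) : Set where
  field
    to        : Fin m → Fin n
    injective : Injective _≡_ _≡_ to
    embeds    : Embeds H G to

open Contains

Contains-trans : ∀ {l m n} {F : Graph l} {G : Graph m} {H : Graph n} →
                 Contains F G → Contains G H → Contains F H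
Contains-trans f g = record
  { to        = to g ∘ to f
  ; injective = injective f ∘ injective g
  ; embeds    = λ i j → embeds g (to f i) (to f j) ⇔-∘ embeds f i j
  }

¬Contains : ∀ {m n} {H : Graph m} {G : Graph n} → (H -Free) G → ¬ Contains H G
¬Contains free h = free (to h , injective h , embeds h)

module _ {m n} (H : Graph m) (G : Graph n) where
  private
    module H = Graph H
    module G = Graph G

  agreeing⇒embeds : ∀ {f} → (∀ i j → does (i H.~? j) ≡ does (f i G.~? f j)) → Embeds H G f
  agreeing⇒embeds {f} agree i j = mk⇔
    (λ e → does-true (f i G.~? f j) (trans (sym (agree i j)) (dec-true (i H.~? j) e)))
    (λ e → does-true (i H.~? j) (trans (agree i j) (dec-true (f i G.~? f j) e)))

-- Configurations: partially decided graphs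

-- A graph on the vertices 0, …, size - 1, numbered in order of introduction, of
-- which only part of the adjacency relation has been decided.
record Config : Set where
  constructor config
  field
    size  : ℕ
    known : ℕ → ℕ → Maybe Bool

open Config

⌊_⌋ : ∀ {m} → Graph m → Config
⌊_⌋ {m} H = config m known′
  where
  open Graph H
  known′ : ℕ → ℕ → Maybe Bool
  known′ i j with i <? m | j <? m
  ... | yes i<m | yes j<m = just (does (fromℕ< i<m ~? fromℕ< j<m))
  ... | _       | _       = nothing

fresh : Config → Config
fresh (config k known) = config (suc k) known′
  where
  known′ : ℕ → ℕ → Maybe Bool
  known′ i j with i ≟ k | j ≟ k
  ... | no  _ | no  _ = known i j
  -- The diagonal entry is decided at once because `Occurs` also compares pairs with `i` equal to
  -- `j`; the remaining entries of the new vertex stay open.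
  ... | yes _ | yes _ = just false
  ... | _     | _     = nothing

assume : ℕ → ℕ → Bool → Config → Config
assume u v b (config k known) = config k known′
  where
  known′ : ℕ → ℕ → Maybe Bool
  known′ i j with (i ≟ u ×-dec j ≟ v) ⊎-dec (i ≟ v ×-dec j ≟ u)
  ... | yes _ = just b
  ... | no  _ = known i j

-- The new vertex gets the number `size c`; the two entries are those that `Expanding` guarantees
-- for the edge from `x` to `y`.
attach : ℕ → ℕ → Config → Config
attach x y c = assume y (size c) false (assume x (size c) true (fresh c))

-- Every pair must be decided, so the listed vertices induce `H` in each realisation, however the
-- open pairs turn out.
Occurs : ∀ {m} → Config → Graph m → Vec ℕ m → Set
Occurs c H vs =
  (∀ i → lookup vs i < size c) ×
  (∀ i j → lookup vs i ≡ lookup vs j → i ≡ j) ×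
  (∀ i j → known c (lookup vs i) (lookup vs j) ≡ just (does (Graph._~?_ H i j)))

occurs? : ∀ {m} c (H : Graph m) vs → Dec (Occurs c H vs)
occurs? c H vs =
  Fin.all? (λ i → lookup vs i <? size c) ×-dec
  Fin.all? (λ i → Fin.all? λ j → (lookup vs i ≟ lookup vs j) →-dec (i Fin.≟ j)) ×-dec
  Fin.all? (λ i → Fin.all? λ j →
    Maybe.≡-dec Bool._≟_ (known c (lookup vs i) (lookup vs j)) (just (does (Graph._~?_ H i j))))

-- Reasons for the new vertex z provided by Expanding, with x ~ z, y ≁ z, z ≢ y
-- and z ≢ w, to differ from v.
Apart : Config → (x y w v : ℕ) → Set
Apart c x y w v =
  v ≡ x ⊎ v ≡ y ⊎ v ≡ w ⊎ known c x v ≡ just false ⊎ known c y v ≡ just true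

Attachable : Config → (x y w : ℕ) → Set
Attachable c x y w = x < size c × y < size c × known c x y ≡ just true ×
  (∀ (i : Fin (size c)) → Apart c x y w (toℕ i))

attachable? : ∀ c x y w → Dec (Attachable c x y w)
attachable? c x y w = x <? size c ×-dec y <? size c ×-dec known c x y ≟′ just true ×-dec
  Fin.all? λ i → let v = toℕ i in
    v ≟ x ⊎-dec v ≟ y ⊎-dec v ≟ w ⊎-dec known c x v ≟′ just false ⊎-dec known c y v ≟′ just true
  where
  infix 4 _≟′_
  _≟′_ = Maybe.≡-dec Bool._≟_

-- Realising configurations in a graph

module _ {n} (G : Graph n) where
  open Graph G

  -- Quantifying over w says that N(x) ∖ N[y] has at least two elements.
  Expanding : Set
  Expanding = ∀ x y w → x ~ y → ∃[ z ] x ~ z × ¬ (y ~ z) × z ≢ y × z ≢ w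

  -- `ρ` is total on ℕ so that adding a vertex is a pointwise update. Undecided pairs are left
  -- unconstrained.
  record _Realises_ (ρ : ℕ → Fin n) (c : Config) : Set where
    field
      distinct : ∀ {i j} → i < size c → j < size c → ρ i ≡ ρ j → i ≡ j
      agrees   : ∀ {i j b} → known c i j ≡ just b → does (ρ i ~? ρ j) ≡ b

  open _Realises_

  _[_≔_] : (ℕ → Fin n) → ℕ → Fin n → ℕ → Fin n
  (ρ [ k ≔ z ]) i with i ≟ k
  ... | yes _ = z
  ... | no  _ = ρ i

  ≔-minimal : ∀ ρ {k z i} → i < k → (ρ [ k ≔ z ]) i ≡ ρ i
  ≔-minimal ρ {k} {z} {i} i<k with i ≟ k
  ... | yes i≡k = contradiction i≡k (ℕ.<⇒≢ i<k)
  ... | no  _   = refl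

  ≔-updates : ∀ ρ k {z} → (ρ [ k ≔ z ]) k ≡ z
  ≔-updates ρ k with k ≟ k
  ... | yes _  = refl
  ... | no k≢k = contradiction refl k≢k

  ≔-agrees : ∀ ρ {k i z b} → i < k → does (ρ i ~? z) ≡ b →
             does ((ρ [ k ≔ z ]) i ~? (ρ [ k ≔ z ]) k) ≡ b
  ≔-agrees ρ {k} i<k eq =
    trans (cong₂ (λ u v → does (u ~? v)) (≔-minimal ρ i<k) (≔-updates ρ k)) eq

  realises-graph : ∀ {m} {H : Graph m} → (h : Contains H G) → Fin n →
                   ∃[ ρ ] ρ Realises ⌊ H ⌋ × (∀ i → ρ (toℕ i) ≡ to h i)
  realises-graph {m} {H} h v₀ = ρ , r , ρ≗h
    where
    module H = Graph H
    ρ : ℕ → Fin n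
    ρ i with i <? m
    ... | yes i<m = to h (fromℕ< i<m)
    -- A default past the last vertex of `H`, where `⌊ H ⌋` decides no pair.
    ... | no  _   = v₀

    ρ≗h : ∀ i → ρ (toℕ i) ≡ to h i
    ρ≗h i with toℕ i <? m
    ... | yes i<m = cong (to h) (Fin.fromℕ<-toℕ i i<m)
    ... | no  i≮m = contradiction (Fin.toℕ<n i) i≮m

    r : ρ Realises ⌊ H ⌋
    r .distinct {i} {j} i<m j<m eq with i <? m | j <? m
    ... | yes p | yes q = Fin.fromℕ<-injective _ _ p q (injective h eq)
    ... | no ¬p | _     = contradiction i<m ¬p
    ... | yes _ | no ¬q = contradiction j<m ¬q
    r .agrees {i} {j} eq with i <? m | j <? m | eq
    ... | yes p | yes q | refl = sym (does-⇔ (embeds h _ _) (_ H.~? _) (_ ~? _))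

  realises-fresh : ∀ {ρ c z} → ρ Realises c → (∀ {i} → i < size c → ρ i ≢ z) →
                   (ρ [ size c ≔ z ]) Realises fresh c
  realises-fresh {ρ} {c} {z} r new .distinct {i} {j} (s≤s i≤k) (s≤s j≤k) eq
    with i ≟ size c | j ≟ size c
  ... | yes i≡k | yes j≡k = trans i≡k (sym j≡k)
  ... | yes _   | no j≢k  = contradiction (sym eq) (new (ℕ.≤∧≢⇒< j≤k j≢k))
  ... | no i≢k  | yes _   = contradiction eq (new (ℕ.≤∧≢⇒< i≤k i≢k))
  ... | no i≢k  | no j≢k  = r .distinct (ℕ.≤∧≢⇒< i≤k i≢k) (ℕ.≤∧≢⇒< j≤k j≢k) eq
  realises-fresh {ρ} {c} {z} r new .agrees {i} {j} eq with i ≟ size c | j ≟ size c | eq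
  ... | yes _ | yes _ | refl = dec-false (z ~? z) ~-irrefl
  ... | no  _ | no  _ | eq′  = r .agrees eq′

  realises-assume : ∀ {ρ c} u v {b} → ρ Realises c → does (ρ u ~? ρ v) ≡ b →
                    ρ Realises assume u v b c
  realises-assume u v r uv .distinct = r .distinct
  realises-assume {ρ} u v r uv .agrees {i} {j} eq
    with (i ≟ u ×-dec j ≟ v) ⊎-dec (i ≟ v ×-dec j ≟ u) | eq
  ... | yes (inj₁ (refl , refl)) | refl = uv
  ... | yes (inj₂ (refl , refl)) | refl =
    trans (does-⇔ (mk⇔ ~-sym ~-sym) (ρ v ~? ρ u) (ρ u ~? ρ v)) uv
  ... | no  _                    | eq′  = r .agrees eq′

  -- Supplies the root of the case tree for a vertex outside a copy of `H`: of the pairs joining the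
  -- new vertex `m` to the copy, only the one contact edge is decided.
  realises-pendant : ∀ {m} {H : Graph m} (h : Contains H G) {z} → (∀ i → to h i ≢ z) →
                     ∀ i → to h i ~ z → ∃[ ρ ] ρ Realises assume (toℕ i) m true (fresh ⌊ H ⌋)
  realises-pendant {m} h {z} z∉h i hi~z =
    let ρ , r , ρ≗h = realises-graph h z in
    ρ [ m ≔ z ] ,
    realises-assume (toℕ i) m
      (realises-fresh r λ j<m ρj≡z → z∉h (fromℕ< j<m)
        (trans (sym (ρ≗h (fromℕ< j<m))) (trans (cong ρ (Fin.toℕ-fromℕ< j<m)) ρj≡z)))
      (≔-agrees ρ (Fin.toℕ<n i)
        (dec-true (ρ (toℕ i) ~? z) (subst (_~ z) (sym (ρ≗h i)) hi~z)))

  realises-occurs : ∀ {m ρ c} {H : Graph m} vs → {True (occurs? c H vs)} → ρ Realises c →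
                    Contains H G
  realises-occurs {ρ = ρ} {c} {H} vs {ok} r =
    let bounded , inj , edges = toWitness {a? = occurs? c H vs} ok in record
    { to        = ρ ∘ lookup vs
    ; injective = λ {i} {j} eq → inj i j (r .distinct (bounded i) (bounded j) eq)
    ; embeds    = agreeing⇒embeds H G (λ i j → sym (r .agrees (edges i j)))
    }

  realises-attach : ∀ {ρ c} x y w → Expanding → ρ Realises c → Attachable c x y w →
                    ∃[ ρ′ ] ρ′ Realises attach x y c
  realises-attach {ρ} {c} x y w expanding r (x<k , y<k , xy , apart)
    with expanding (ρ x) (ρ y) (ρ w) (does-true (ρ x ~? ρ y) (r .agrees xy))
  ... | z , x~z , y≁z , z≢y , z≢w =
    ρ [ k ≔ z ] ,
    realises-assume y k
      (realises-assume x k (realises-fresh r new) (≔-agrees ρ x<k (dec-true (ρ x ~? z) x~z)))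
      (≔-agrees ρ y<k (dec-false (ρ y ~? z) y≁z))
    where
    k = size c

    differs : ∀ {v} → Apart c x y w v → ρ v ≢ z
    differs (inj₁ refl) refl = ~-irrefl x~z
    differs (inj₂ (inj₁ refl)) refl = z≢y refl
    differs (inj₂ (inj₂ (inj₁ refl))) refl = z≢w refl
    differs (inj₂ (inj₂ (inj₂ (inj₁ xv)))) refl = does-false (ρ x ~? _) (r .agrees xv) x~z
    differs (inj₂ (inj₂ (inj₂ (inj₂ yv)))) refl = y≁z (does-true (ρ y ~? _) (r .agrees yv))

    new : ∀ {i} → i < k → ρ i ≢ z
    new i<k = differs (subst (Apart c x y w) (Fin.toℕ-fromℕ< i<k) (apart (fromℕ< i<k)))

  -- Case trees and their soundness

  -- Case trees are data, so that each leaf and each extension is checked by evaluation on the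
  -- concrete configuration, independently of `G`; the hidden `True` arguments are solved by that
  -- evaluation.
  data Derivation (A : Set) (c : Config) : Set₁ where
    occurs : ∀ {m} {H : Graph m} → (Contains H G → A) →
             ∀ vs → {True (occurs? c H vs)} → Derivation A c
    split  : ∀ u v → Derivation A (assume u v true c) → Derivation A (assume u v false c) →
             Derivation A c
    -- `w` is the one further vertex that the new vertex must avoid; the trees repeat `y` when there
    -- is none.
    extend : ∀ x y w → {True (attachable? c x y w)} → Derivation A (attach x y c) →
             Derivation A c

  -- Induction on the tree: at a split, the actual adjacency in `G` selects the branch, and `ρ`
  -- keeps realising the current configuration.
  derive : ∀ {A c ρ} → Expanding → Derivation A c → ρ Realises c → A
  derive expanding (occurs conclude vs {ok}) r = conclude (realises-occurs vs {ok} r)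
  derive {ρ = ρ} expanding (split u v d e) r with does (ρ u ~? ρ v) in eq
  ... | true  = derive expanding d (realises-assume u v r eq)
  ... | false = derive expanding e (realises-assume u v r eq)
  derive {c = c} expanding (extend x y w {ok} d) r =
    let ok′ = toWitness {a? = attachable? c x y w} ok
    in derive expanding d (proj₂ (realises-attach x y w expanding r ok′))

-- The case trees

-- The case trees were found by a computer search minimising the branching.  A is
-- kept general so that forbidden graphs may be sent to a Petersen graph or to ⊥.
module Derivations {n} (G : Graph n) (expanding : Expanding G) {A : Set}
  (p₇ : Contains (P 7) G → A) (c₇ : Contains (C 7) G → A)
  (c₄ : Contains (C 4) G → A) (d : Contains diamond G → A)
  where

  derive-graph : ∀ {m} {H : Graph (suc m)} → Derivation G A ⌊ H ⌋ → Contains H G → A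
  derive-graph t h =
    let ρ , r , _ = realises-graph G h (to h zero) in derive G expanding t r

  -- The Petersen graph is a hexagon together with a claw whose three leaves are joined to the three
  -- pairs of opposite vertices. The tree tries to build that claw around the hexagon 0 to 5; every
  -- deviating branch meets a forbidden graph.
  derive-C₆ : (Contains petersen G → A) → Contains (C 6) G → A
  derive-C₆ petersen = derive-graph $
    extend 0 1 5 $
    split 6 2 (occurs c₄ (0 ∷ 1 ∷ 2 ∷ 6 ∷ [])) $
    -- Two non-adjacent vertices have at most one common neighbour: a second one gives a C₄ or, if
    -- it is adjacent to the first, a diamond. Many splits below close in this way. In a diamond,
    -- the first two listed vertices are those of degree three.
    split 6 4
      (split 6 5 (occurs d (5 ∷ 6 ∷ 0 ∷ 4 ∷ [])) $
       occurs c₄ (0 ∷ 5 ∷ 4 ∷ 6 ∷ [])) $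
    -- If 6 sees the opposite vertex 3, it is a candidate for a leaf of the claw.
    split 6 3
      (split 6 5 (occurs c₄ (3 ∷ 4 ∷ 5 ∷ 6 ∷ [])) $
       extend 6 0 3 $
       split 7 1 (occurs c₄ (0 ∷ 1 ∷ 7 ∷ 6 ∷ [])) $
       split 7 5 (occurs c₄ (0 ∷ 5 ∷ 7 ∷ 6 ∷ [])) $
       split 7 2
         (split 7 3 (occurs d (3 ∷ 7 ∷ 2 ∷ 6 ∷ [])) $
          occurs c₄ (2 ∷ 3 ∷ 6 ∷ 7 ∷ [])) $
       split 7 4
         (split 7 3 (occurs d (3 ∷ 7 ∷ 4 ∷ 6 ∷ [])) $
          occurs c₄ (3 ∷ 4 ∷ 7 ∷ 6 ∷ [])) $
       split 7 3
         (extend 7 3 3 $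
          split 8 2 (occurs c₄ (2 ∷ 3 ∷ 7 ∷ 8 ∷ [])) $
          split 8 4 (occurs c₄ (3 ∷ 4 ∷ 8 ∷ 7 ∷ [])) $
          split 8 6 (occurs d (6 ∷ 7 ∷ 3 ∷ 8 ∷ [])) $
          split 8 0 (occurs c₄ (0 ∷ 6 ∷ 7 ∷ 8 ∷ [])) $
          split 8 1
            (split 8 5 (occurs c₄ (0 ∷ 1 ∷ 8 ∷ 5 ∷ [])) $
             occurs c₇ (0 ∷ 1 ∷ 8 ∷ 7 ∷ 3 ∷ 4 ∷ 5 ∷ [])) $
          split 8 5 (occurs c₇ (0 ∷ 1 ∷ 2 ∷ 3 ∷ 7 ∷ 8 ∷ 5 ∷ [])) $
          occurs p₇ (1 ∷ 0 ∷ 5 ∷ 4 ∷ 3 ∷ 7 ∷ 8 ∷ [])) $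
       -- Among 0 to 6, vertex 7 now sees only 6, as the centre of the claw should; 8 is the
       -- candidate for the leaf at the opposite pair 1, 4.
       extend 1 0 2 $
       split 8 5 (occurs c₄ (0 ∷ 1 ∷ 8 ∷ 5 ∷ [])) $
       split 8 6 (occurs c₄ (0 ∷ 1 ∷ 8 ∷ 6 ∷ [])) $
       split 8 3
         (split 8 2 (occurs d (2 ∷ 8 ∷ 1 ∷ 3 ∷ [])) $
          occurs c₄ (1 ∷ 2 ∷ 3 ∷ 8 ∷ [])) $
       split 8 2
         (split 8 4 (occurs c₄ (2 ∷ 3 ∷ 4 ∷ 8 ∷ [])) $
          split 8 7 (occurs p₇ (0 ∷ 5 ∷ 4 ∷ 3 ∷ 2 ∷ 8 ∷ 7 ∷ [])) $
          extend 8 1 1 $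
          split 9 0 (occurs c₄ (0 ∷ 1 ∷ 8 ∷ 9 ∷ [])) $
          split 9 2 (occurs d (2 ∷ 8 ∷ 1 ∷ 9 ∷ [])) $
          split 9 3 (occurs c₄ (2 ∷ 3 ∷ 9 ∷ 8 ∷ [])) $
          split 9 4
            (split 9 6 (occurs c₄ (3 ∷ 4 ∷ 9 ∷ 6 ∷ [])) $
             occurs c₇ (0 ∷ 1 ∷ 8 ∷ 9 ∷ 4 ∷ 3 ∷ 6 ∷ [])) $
          split 9 5
            (split 9 6 (occurs c₄ (0 ∷ 5 ∷ 9 ∷ 6 ∷ [])) $
             occurs c₇ (0 ∷ 5 ∷ 9 ∷ 8 ∷ 2 ∷ 3 ∷ 6 ∷ []))
            (occurs p₇ (0 ∷ 5 ∷ 4 ∷ 3 ∷ 2 ∷ 8 ∷ 9 ∷ []))) $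
       split 8 7
         (split 8 4
            (extend 2 1 3 $
             split 9 0 (occurs c₄ (0 ∷ 1 ∷ 2 ∷ 9 ∷ [])) $
             split 9 8 (occurs c₄ (1 ∷ 2 ∷ 9 ∷ 8 ∷ [])) $
             split 9 4
               (split 9 3 (occurs d (3 ∷ 9 ∷ 2 ∷ 4 ∷ [])) $
                occurs c₄ (2 ∷ 3 ∷ 4 ∷ 9 ∷ [])) $
             split 9 6
               (split 9 3 (occurs d (3 ∷ 9 ∷ 2 ∷ 6 ∷ [])) $
                occurs c₄ (2 ∷ 3 ∷ 6 ∷ 9 ∷ [])) $
             split 9 3
               (split 9 5 (occurs c₄ (3 ∷ 4 ∷ 5 ∷ 9 ∷ [])) $
                split 9 7 (occurs c₄ (3 ∷ 6 ∷ 7 ∷ 9 ∷ [])) $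
                extend 9 2 2 $
                split 10 1 (occurs c₄ (1 ∷ 2 ∷ 9 ∷ 10 ∷ [])) $
                split 10 3 (occurs d (3 ∷ 9 ∷ 2 ∷ 10 ∷ [])) $
                split 10 4 (occurs c₄ (3 ∷ 4 ∷ 10 ∷ 9 ∷ [])) $
                split 10 6 (occurs c₄ (3 ∷ 6 ∷ 10 ∷ 9 ∷ [])) $
                split 10 0
                  (split 10 8 (occurs c₄ (0 ∷ 1 ∷ 8 ∷ 10 ∷ [])) $
                   occurs c₇ (0 ∷ 1 ∷ 8 ∷ 4 ∷ 3 ∷ 9 ∷ 10 ∷ [])) $
                split 10 7 (occurs c₇ (0 ∷ 1 ∷ 2 ∷ 9 ∷ 10 ∷ 7 ∷ 6 ∷ [])) $
                occurs p₇ (7 ∷ 6 ∷ 0 ∷ 1 ∷ 2 ∷ 9 ∷ 10 ∷ [])) $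
             split 9 5
               -- Leaves 6, 8, 9 see the pairs 0 3, 1 4, 2 5, and 7 is the centre. The list gives
               -- the outer pentagon 0, 1, 2, 3, 6 and then the other ends of its spokes.
               (split 9 7 (occurs petersen (0 ∷ 1 ∷ 2 ∷ 3 ∷ 6 ∷ 5 ∷ 8 ∷ 9 ∷ 4 ∷ 7 ∷ [])) $
                occurs p₇ (2 ∷ 9 ∷ 5 ∷ 0 ∷ 6 ∷ 7 ∷ 8 ∷ [])) $
             split 9 7 (occurs p₇ (0 ∷ 5 ∷ 4 ∷ 3 ∷ 2 ∷ 9 ∷ 7 ∷ [])) $
             extend 9 2 2 $
             split 10 1 (occurs c₄ (1 ∷ 2 ∷ 9 ∷ 10 ∷ [])) $
             split 10 3 (occurs c₄ (2 ∷ 3 ∷ 10 ∷ 9 ∷ [])) $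
             split 10 0
               (split 10 8 (occurs c₄ (0 ∷ 1 ∷ 8 ∷ 10 ∷ [])) $
                split 10 4
                  (split 10 5 (occurs d (5 ∷ 10 ∷ 0 ∷ 4 ∷ [])) $
                   occurs c₄ (0 ∷ 5 ∷ 4 ∷ 10 ∷ []))
                  (occurs p₇ (0 ∷ 10 ∷ 9 ∷ 2 ∷ 3 ∷ 4 ∷ 8 ∷ []))) $
             split 10 4
               (split 10 6 (occurs c₄ (3 ∷ 4 ∷ 10 ∷ 6 ∷ [])) $
                occurs p₇ (1 ∷ 0 ∷ 6 ∷ 3 ∷ 4 ∷ 10 ∷ 9 ∷ [])) $
             split 10 5
               (split 10 6 (occurs c₄ (0 ∷ 5 ∷ 10 ∷ 6 ∷ [])) $
                occurs c₇ (0 ∷ 5 ∷ 10 ∷ 9 ∷ 2 ∷ 3 ∷ 6 ∷ []))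
               (occurs p₇ (0 ∷ 5 ∷ 4 ∷ 3 ∷ 2 ∷ 9 ∷ 10 ∷ [])))
            (occurs p₇ (1 ∷ 8 ∷ 7 ∷ 6 ∷ 3 ∷ 4 ∷ 5 ∷ []))) $
       split 8 4
         (extend 7 6 6 $
          split 9 0 (occurs c₄ (0 ∷ 6 ∷ 7 ∷ 9 ∷ [])) $
          split 9 3 (occurs c₄ (3 ∷ 6 ∷ 7 ∷ 9 ∷ [])) $
          split 9 1
            (split 9 5 (occurs c₄ (0 ∷ 1 ∷ 9 ∷ 5 ∷ [])) $
             split 9 4
               (split 9 8 (occurs d (8 ∷ 9 ∷ 1 ∷ 4 ∷ [])) $
                occurs c₄ (1 ∷ 8 ∷ 4 ∷ 9 ∷ []))
               (occurs p₇ (1 ∷ 9 ∷ 7 ∷ 6 ∷ 3 ∷ 4 ∷ 5 ∷ []))) $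
          split 9 4
            (split 9 2 (occurs c₄ (2 ∷ 3 ∷ 4 ∷ 9 ∷ [])) $
             occurs p₇ (0 ∷ 1 ∷ 2 ∷ 3 ∷ 4 ∷ 9 ∷ 7 ∷ [])) $
          split 9 8
            (split 9 2 (occurs c₄ (1 ∷ 2 ∷ 9 ∷ 8 ∷ [])) $
             occurs c₇ (1 ∷ 2 ∷ 3 ∷ 6 ∷ 7 ∷ 9 ∷ 8 ∷ []))
            (occurs p₇ (1 ∷ 8 ∷ 4 ∷ 3 ∷ 6 ∷ 7 ∷ 9 ∷ []))) $
       extend 8 1 1 $
       split 9 0 (occurs c₄ (0 ∷ 1 ∷ 8 ∷ 9 ∷ [])) $
       split 9 2 (occurs c₄ (1 ∷ 2 ∷ 9 ∷ 8 ∷ [])) $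
       split 9 5
         (split 9 6 (occurs c₄ (0 ∷ 5 ∷ 9 ∷ 6 ∷ [])) $
          split 9 3
            (split 9 4 (occurs d (4 ∷ 9 ∷ 3 ∷ 5 ∷ [])) $
             occurs c₄ (3 ∷ 4 ∷ 5 ∷ 9 ∷ []))
            (occurs p₇ (2 ∷ 3 ∷ 6 ∷ 0 ∷ 5 ∷ 9 ∷ 8 ∷ []))) $
       split 9 7
         (split 9 4 (occurs p₇ (2 ∷ 1 ∷ 0 ∷ 5 ∷ 4 ∷ 9 ∷ 7 ∷ [])) $
          occurs p₇ (4 ∷ 5 ∷ 0 ∷ 1 ∷ 8 ∷ 9 ∷ 7 ∷ [])) $
       split 9 3
         (split 9 4
            (split 9 6 (occurs d (3 ∷ 9 ∷ 4 ∷ 6 ∷ [])) $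
             occurs p₇ (4 ∷ 9 ∷ 8 ∷ 1 ∷ 0 ∷ 6 ∷ 7 ∷ []))
            (occurs c₇ (0 ∷ 1 ∷ 8 ∷ 9 ∷ 3 ∷ 4 ∷ 5 ∷ []))) $
       split 9 4
         (split 9 6 (occurs c₄ (3 ∷ 4 ∷ 9 ∷ 6 ∷ [])) $
          occurs c₇ (0 ∷ 1 ∷ 8 ∷ 9 ∷ 4 ∷ 3 ∷ 6 ∷ []))
         (occurs p₇ (3 ∷ 4 ∷ 5 ∷ 0 ∷ 1 ∷ 8 ∷ 9 ∷ []))) $
    -- Vertex 6 now misses 1, 2, 3 and 4, so it either forms a triangle with 0 and 5 or sees only 0
    -- on the hexagon. Both cases end in forbidden graphs alone.
    split 6 5
      (extend 1 2 0 $
       split 7 3 (occurs c₄ (1 ∷ 2 ∷ 3 ∷ 7 ∷ [])) $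
       split 7 0
         (split 7 5 (occurs d (0 ∷ 7 ∷ 1 ∷ 5 ∷ [])) $
          split 7 4 (occurs c₄ (0 ∷ 5 ∷ 4 ∷ 7 ∷ [])) $
          split 7 6 (occurs d (0 ∷ 6 ∷ 5 ∷ 7 ∷ [])) $
          occurs p₇ (6 ∷ 5 ∷ 4 ∷ 3 ∷ 2 ∷ 1 ∷ 7 ∷ [])) $
       split 7 5 (occurs c₄ (0 ∷ 1 ∷ 7 ∷ 5 ∷ [])) $
       split 7 6 (occurs c₄ (0 ∷ 1 ∷ 7 ∷ 6 ∷ [])) $
       split 7 4
         (extend 6 0 0 $
          split 8 1 (occurs c₄ (0 ∷ 1 ∷ 8 ∷ 6 ∷ [])) $
          split 8 5 (occurs d (5 ∷ 6 ∷ 0 ∷ 8 ∷ [])) $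
          split 8 4 (occurs c₄ (4 ∷ 5 ∷ 6 ∷ 8 ∷ [])) $
          split 8 2
            (split 8 7 (occurs c₄ (1 ∷ 2 ∷ 8 ∷ 7 ∷ [])) $
             occurs c₇ (1 ∷ 2 ∷ 8 ∷ 6 ∷ 5 ∷ 4 ∷ 7 ∷ [])) $
          split 8 3
            (split 8 7 (occurs c₄ (3 ∷ 4 ∷ 7 ∷ 8 ∷ [])) $
             occurs c₇ (0 ∷ 1 ∷ 7 ∷ 4 ∷ 3 ∷ 8 ∷ 6 ∷ []))
            (occurs p₇ (1 ∷ 2 ∷ 3 ∷ 4 ∷ 5 ∷ 6 ∷ 8 ∷ [])))
         (occurs p₇ (6 ∷ 5 ∷ 4 ∷ 3 ∷ 2 ∷ 1 ∷ 7 ∷ []))) $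
    extend 2 3 1 $
    split 7 4 (occurs c₄ (2 ∷ 3 ∷ 4 ∷ 7 ∷ [])) $
    split 7 0
      (split 7 1 (occurs d (1 ∷ 7 ∷ 0 ∷ 2 ∷ [])) $
       occurs c₄ (0 ∷ 1 ∷ 2 ∷ 7 ∷ [])) $
    split 7 6
      (split 7 5 (occurs c₄ (0 ∷ 5 ∷ 7 ∷ 6 ∷ [])) $
       occurs c₇ (0 ∷ 5 ∷ 4 ∷ 3 ∷ 2 ∷ 7 ∷ 6 ∷ [])) $
    split 7 5
      (split 7 1 (occurs c₄ (0 ∷ 1 ∷ 7 ∷ 5 ∷ [])) $
       extend 4 3 5 $
       split 8 2 (occurs c₄ (2 ∷ 3 ∷ 4 ∷ 8 ∷ [])) $
       split 8 7
         (split 8 5 (occurs d (5 ∷ 8 ∷ 4 ∷ 7 ∷ [])) $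
          occurs c₄ (4 ∷ 5 ∷ 7 ∷ 8 ∷ [])) $
       split 8 0
         (split 8 5 (occurs d (5 ∷ 8 ∷ 0 ∷ 4 ∷ [])) $
          occurs c₄ (0 ∷ 5 ∷ 4 ∷ 8 ∷ [])) $
       split 8 6 (occurs p₇ (0 ∷ 6 ∷ 8 ∷ 4 ∷ 3 ∷ 2 ∷ 7 ∷ [])) $
       split 8 1
         (split 8 5 (occurs c₄ (0 ∷ 1 ∷ 8 ∷ 5 ∷ [])) $
          extend 6 0 0 $
          split 9 1 (occurs c₄ (0 ∷ 1 ∷ 9 ∷ 6 ∷ [])) $
          split 9 5 (occurs c₄ (0 ∷ 5 ∷ 9 ∷ 6 ∷ [])) $
          split 9 2
            (split 9 8 (occurs c₄ (1 ∷ 2 ∷ 9 ∷ 8 ∷ [])) $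
             split 9 4
               (split 9 3 (occurs d (3 ∷ 9 ∷ 2 ∷ 4 ∷ [])) $
                occurs c₄ (2 ∷ 3 ∷ 4 ∷ 9 ∷ []))
               (occurs p₇ (2 ∷ 9 ∷ 6 ∷ 0 ∷ 5 ∷ 4 ∷ 8 ∷ []))) $
          split 9 4
            (split 9 7 (occurs c₄ (4 ∷ 5 ∷ 7 ∷ 9 ∷ [])) $
             occurs p₇ (1 ∷ 2 ∷ 7 ∷ 5 ∷ 4 ∷ 9 ∷ 6 ∷ [])) $
          split 9 3
            (split 9 7 (occurs c₄ (2 ∷ 3 ∷ 9 ∷ 7 ∷ [])) $
             occurs c₇ (0 ∷ 5 ∷ 7 ∷ 2 ∷ 3 ∷ 9 ∷ 6 ∷ []))
            (occurs p₇ (2 ∷ 3 ∷ 4 ∷ 5 ∷ 0 ∷ 6 ∷ 9 ∷ [])))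
         (occurs p₇ (6 ∷ 0 ∷ 1 ∷ 2 ∷ 3 ∷ 4 ∷ 8 ∷ [])))
      (occurs p₇ (6 ∷ 0 ∷ 5 ∷ 4 ∷ 3 ∷ 2 ∷ 7 ∷ []))

  derive-C₅ : (Contains (C 6) G → A) → Contains (C 5) G → A
  derive-C₅ c₆ = derive-graph $
    extend 0 1 4 $
    split 5 2 (occurs c₄ (0 ∷ 1 ∷ 2 ∷ 5 ∷ [])) $
    split 5 3
      (split 5 4 (occurs d (4 ∷ 5 ∷ 0 ∷ 3 ∷ [])) $
       occurs c₄ (0 ∷ 4 ∷ 3 ∷ 5 ∷ [])) $
    -- Vertex 5 misses 1, 2 and 3, so it either forms a triangle with 0 and 4 or sees only 0 on the
    -- pentagon.
    split 5 4
      (extend 1 2 0 $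
       split 6 3 (occurs c₄ (1 ∷ 2 ∷ 3 ∷ 6 ∷ [])) $
       split 6 5
         (split 6 0 (occurs d (0 ∷ 6 ∷ 1 ∷ 5 ∷ [])) $
          occurs c₄ (0 ∷ 1 ∷ 6 ∷ 5 ∷ [])) $
       split 6 4
         (split 6 0 (occurs d (0 ∷ 4 ∷ 5 ∷ 6 ∷ [])) $
          occurs c₄ (0 ∷ 1 ∷ 6 ∷ 4 ∷ [])) $
       split 6 0
         (extend 5 0 0 $
          split 7 1 (occurs c₄ (0 ∷ 1 ∷ 7 ∷ 5 ∷ [])) $
          split 7 4 (occurs d (4 ∷ 5 ∷ 0 ∷ 7 ∷ [])) $
          split 7 3 (occurs c₄ (3 ∷ 4 ∷ 5 ∷ 7 ∷ [])) $
          split 7 6 (occurs c₄ (0 ∷ 5 ∷ 7 ∷ 6 ∷ [])) $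
          split 7 2
            (extend 3 2 4 $
             split 8 1 (occurs c₄ (1 ∷ 2 ∷ 3 ∷ 8 ∷ [])) $
             split 8 7 (occurs c₄ (2 ∷ 3 ∷ 8 ∷ 7 ∷ [])) $
             split 8 0
               (split 8 4 (occurs d (4 ∷ 8 ∷ 0 ∷ 3 ∷ [])) $
                occurs c₄ (0 ∷ 4 ∷ 3 ∷ 8 ∷ [])) $
             split 8 5 (occurs c₆ (0 ∷ 1 ∷ 2 ∷ 3 ∷ 8 ∷ 5 ∷ [])) $
             split 8 6 (occurs c₇ (0 ∷ 5 ∷ 7 ∷ 2 ∷ 3 ∷ 8 ∷ 6 ∷ [])) $
             occurs p₇ (6 ∷ 0 ∷ 5 ∷ 7 ∷ 2 ∷ 3 ∷ 8 ∷ []))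
            (occurs p₇ (6 ∷ 1 ∷ 2 ∷ 3 ∷ 4 ∷ 5 ∷ 7 ∷ []))) $
       extend 5 0 0 $
       split 7 1 (occurs c₄ (0 ∷ 1 ∷ 7 ∷ 5 ∷ [])) $
       split 7 4 (occurs d (4 ∷ 5 ∷ 0 ∷ 7 ∷ [])) $
       split 7 3 (occurs c₄ (3 ∷ 4 ∷ 5 ∷ 7 ∷ [])) $
       split 7 6
         (split 7 2 (occurs c₄ (1 ∷ 2 ∷ 7 ∷ 6 ∷ [])) $
          occurs c₇ (1 ∷ 2 ∷ 3 ∷ 4 ∷ 5 ∷ 7 ∷ 6 ∷ [])) $
       split 7 2
         (extend 4 0 3 $
          split 8 1 (occurs c₄ (0 ∷ 1 ∷ 8 ∷ 4 ∷ [])) $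
          split 8 5 (occurs d (4 ∷ 5 ∷ 0 ∷ 8 ∷ [])) $
          split 8 7 (occurs c₄ (4 ∷ 5 ∷ 7 ∷ 8 ∷ [])) $
          split 8 2
            (split 8 3 (occurs d (3 ∷ 8 ∷ 2 ∷ 4 ∷ [])) $
             occurs c₄ (2 ∷ 3 ∷ 4 ∷ 8 ∷ [])) $
          split 8 6 (occurs c₇ (1 ∷ 2 ∷ 7 ∷ 5 ∷ 4 ∷ 8 ∷ 6 ∷ [])) $
          occurs p₇ (6 ∷ 1 ∷ 2 ∷ 7 ∷ 5 ∷ 4 ∷ 8 ∷ []))
         (occurs p₇ (6 ∷ 1 ∷ 2 ∷ 3 ∷ 4 ∷ 5 ∷ 7 ∷ []))) $
    -- With 5 hanging at 0 alone, a vertex 6 at 2 is added: if it sees 5, then 0, 4, 3, 2, 6, 5 is a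
    -- hexagon.
    extend 2 3 1 $
    split 6 4 (occurs c₄ (2 ∷ 3 ∷ 4 ∷ 6 ∷ [])) $
    split 6 0
      (split 6 1 (occurs d (1 ∷ 6 ∷ 0 ∷ 2 ∷ [])) $
       occurs c₄ (0 ∷ 1 ∷ 2 ∷ 6 ∷ [])) $
    split 6 5 (occurs c₆ (0 ∷ 4 ∷ 3 ∷ 2 ∷ 6 ∷ 5 ∷ [])) $
    split 6 1
      (extend 5 0 0 $
       split 7 1 (occurs c₄ (0 ∷ 1 ∷ 7 ∷ 5 ∷ [])) $
       split 7 4 (occurs c₄ (0 ∷ 4 ∷ 7 ∷ 5 ∷ [])) $
       split 7 2
         (split 7 3
            (split 7 6 (occurs d (2 ∷ 6 ∷ 1 ∷ 7 ∷ [])) $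
             extend 3 2 4 $
             split 8 1 (occurs c₄ (1 ∷ 2 ∷ 3 ∷ 8 ∷ [])) $
             split 8 6 (occurs c₄ (2 ∷ 3 ∷ 8 ∷ 6 ∷ [])) $
             split 8 7 (occurs d (3 ∷ 7 ∷ 2 ∷ 8 ∷ [])) $
             split 8 5 (occurs c₄ (3 ∷ 7 ∷ 5 ∷ 8 ∷ [])) $
             split 8 0
               (split 8 4 (occurs d (4 ∷ 8 ∷ 0 ∷ 3 ∷ [])) $
                occurs c₄ (0 ∷ 4 ∷ 3 ∷ 8 ∷ []))
               (occurs p₇ (6 ∷ 1 ∷ 0 ∷ 5 ∷ 7 ∷ 3 ∷ 8 ∷ [])))
            (occurs c₆ (0 ∷ 4 ∷ 3 ∷ 2 ∷ 7 ∷ 5 ∷ []))) $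
       split 7 3 (occurs c₆ (0 ∷ 1 ∷ 2 ∷ 3 ∷ 7 ∷ 5 ∷ [])) $
       split 7 6 (occurs c₇ (0 ∷ 4 ∷ 3 ∷ 2 ∷ 6 ∷ 7 ∷ 5 ∷ [])) $
       occurs p₇ (6 ∷ 2 ∷ 3 ∷ 4 ∷ 0 ∷ 5 ∷ 7 ∷ [])) $
    extend 5 0 0 $
    split 7 1 (occurs c₄ (0 ∷ 1 ∷ 7 ∷ 5 ∷ [])) $
    split 7 4 (occurs c₄ (0 ∷ 4 ∷ 7 ∷ 5 ∷ [])) $
    split 7 2
      (split 7 3
         (split 7 6 (occurs d (2 ∷ 7 ∷ 3 ∷ 6 ∷ [])) $
          extend 4 0 3 $
          split 8 1 (occurs c₄ (0 ∷ 1 ∷ 8 ∷ 4 ∷ [])) $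
          split 8 5 (occurs c₄ (0 ∷ 4 ∷ 8 ∷ 5 ∷ [])) $
          split 8 2
            (split 8 3 (occurs d (3 ∷ 8 ∷ 2 ∷ 4 ∷ [])) $
             occurs c₄ (2 ∷ 3 ∷ 4 ∷ 8 ∷ [])) $
          split 8 6 (occurs c₆ (0 ∷ 1 ∷ 2 ∷ 6 ∷ 8 ∷ 4 ∷ [])) $
          split 8 7 (occurs c₆ (0 ∷ 1 ∷ 2 ∷ 7 ∷ 8 ∷ 4 ∷ [])) $
          occurs p₇ (6 ∷ 2 ∷ 7 ∷ 5 ∷ 0 ∷ 4 ∷ 8 ∷ []))
         (occurs c₆ (0 ∷ 4 ∷ 3 ∷ 2 ∷ 7 ∷ 5 ∷ []))) $
    split 7 3 (occurs c₆ (0 ∷ 1 ∷ 2 ∷ 3 ∷ 7 ∷ 5 ∷ [])) $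
    split 7 6 (occurs c₆ (0 ∷ 1 ∷ 2 ∷ 6 ∷ 7 ∷ 5 ∷ [])) $
    occurs p₇ (6 ∷ 2 ∷ 3 ∷ 4 ∷ 0 ∷ 5 ∷ 7 ∷ [])

  -- The path grows at both ends alternately, up to 5, 3, 1, 0, 2, 4, 6. A new end misses the
  -- neighbour of the old end by `Expanding`, and its other adjacencies are tested from the nearest
  -- vertex outwards, so the first one found closes an induced cycle of length 4 to 7.
  derive-edge : (Contains (C 5) G → A) → (Contains (C 6) G → A) → Contains (P 2) G → A
  derive-edge c₅ c₆ = derive-graph $
    extend 0 1 1 $
    extend 1 0 0 $
    split 3 2 (occurs c₄ (0 ∷ 1 ∷ 3 ∷ 2 ∷ [])) $
    extend 2 0 0 $
    split 4 1 (occurs c₄ (0 ∷ 1 ∷ 4 ∷ 2 ∷ [])) $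
    split 4 3 (occurs c₅ (0 ∷ 1 ∷ 3 ∷ 4 ∷ 2 ∷ [])) $
    extend 3 1 1 $
    split 5 0 (occurs c₄ (0 ∷ 1 ∷ 3 ∷ 5 ∷ [])) $
    split 5 2 (occurs c₅ (0 ∷ 1 ∷ 3 ∷ 5 ∷ 2 ∷ [])) $
    split 5 4 (occurs c₆ (0 ∷ 1 ∷ 3 ∷ 5 ∷ 4 ∷ 2 ∷ [])) $
    extend 4 2 2 $
    split 6 0 (occurs c₄ (0 ∷ 2 ∷ 4 ∷ 6 ∷ [])) $
    split 6 1 (occurs c₅ (0 ∷ 1 ∷ 6 ∷ 4 ∷ 2 ∷ [])) $
    split 6 3 (occurs c₆ (0 ∷ 1 ∷ 3 ∷ 6 ∷ 4 ∷ 2 ∷ [])) $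
    split 6 5 (occurs c₇ (0 ∷ 1 ∷ 3 ∷ 5 ∷ 6 ∷ 4 ∷ 2 ∷ [])) $
    occurs p₇ (5 ∷ 3 ∷ 1 ∷ 0 ∷ 2 ∷ 4 ∷ 6 ∷ [])

  derive-pendant : ∀ {ρ} → _Realises_ G ρ (assume 0 10 true (fresh ⌊ petersen ⌋)) → A
  derive-pendant = derive G expanding $
    split 10 1
      (split 10 2 (occurs d (1 ∷ 10 ∷ 0 ∷ 2 ∷ [])) $
       split 10 3 (occurs c₄ (1 ∷ 2 ∷ 3 ∷ 10 ∷ [])) $
       split 10 4 (occurs d (0 ∷ 10 ∷ 1 ∷ 4 ∷ [])) $
       split 10 5 (occurs d (0 ∷ 10 ∷ 1 ∷ 5 ∷ [])) $
       split 10 6 (occurs d (1 ∷ 10 ∷ 0 ∷ 6 ∷ [])) $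
       split 10 7 (occurs c₄ (0 ∷ 5 ∷ 7 ∷ 10 ∷ [])) $
       split 10 8 (occurs c₄ (0 ∷ 5 ∷ 8 ∷ 10 ∷ [])) $
       split 10 9 (occurs c₄ (0 ∷ 4 ∷ 9 ∷ 10 ∷ [])) $
       extend 10 0 0 $
       split 11 1 (occurs d (1 ∷ 10 ∷ 0 ∷ 11 ∷ [])) $
       split 11 2 (occurs c₄ (1 ∷ 2 ∷ 11 ∷ 10 ∷ [])) $
       split 11 4 (occurs c₄ (0 ∷ 4 ∷ 11 ∷ 10 ∷ [])) $
       split 11 5 (occurs c₄ (0 ∷ 5 ∷ 11 ∷ 10 ∷ [])) $
       split 11 6 (occurs c₄ (1 ∷ 6 ∷ 11 ∷ 10 ∷ [])) $
       split 11 3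
         (split 11 7 (occurs c₄ (2 ∷ 3 ∷ 11 ∷ 7 ∷ [])) $
          occurs c₇ (0 ∷ 5 ∷ 7 ∷ 2 ∷ 3 ∷ 11 ∷ 10 ∷ [])) $
       split 11 7 (occurs c₇ (0 ∷ 4 ∷ 3 ∷ 2 ∷ 7 ∷ 11 ∷ 10 ∷ [])) $
       occurs p₇ (3 ∷ 2 ∷ 7 ∷ 5 ∷ 0 ∷ 10 ∷ 11 ∷ [])) $
    split 10 2 (occurs c₄ (0 ∷ 1 ∷ 2 ∷ 10 ∷ [])) $
    split 10 6 (occurs c₄ (0 ∷ 1 ∷ 6 ∷ 10 ∷ [])) $
    split 10 3
      (split 10 4 (occurs d (4 ∷ 10 ∷ 0 ∷ 3 ∷ [])) $
       occurs c₄ (0 ∷ 4 ∷ 3 ∷ 10 ∷ [])) $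
    split 10 9
      (split 10 4 (occurs d (4 ∷ 10 ∷ 0 ∷ 9 ∷ [])) $
       occurs c₄ (0 ∷ 4 ∷ 9 ∷ 10 ∷ [])) $
    split 10 7
      (split 10 5 (occurs d (5 ∷ 10 ∷ 0 ∷ 7 ∷ [])) $
       occurs c₄ (0 ∷ 5 ∷ 7 ∷ 10 ∷ [])) $
    split 10 8 (occurs p₇ (0 ∷ 10 ∷ 8 ∷ 3 ∷ 2 ∷ 7 ∷ 9 ∷ [])) $
    -- Vertex 10 now misses 1 and all six vertices at distance two from 0. What remains is a
    -- triangle on the edge 0 4 or 0 5, or 0 as its only neighbour in the Petersen graph.
    split 10 4
      (split 10 5 (occurs d (0 ∷ 10 ∷ 4 ∷ 5 ∷ [])) $
       extend 10 0 0 $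
       split 11 1 (occurs c₄ (0 ∷ 1 ∷ 11 ∷ 10 ∷ [])) $
       split 11 4 (occurs d (4 ∷ 10 ∷ 0 ∷ 11 ∷ [])) $
       split 11 3 (occurs c₄ (3 ∷ 4 ∷ 10 ∷ 11 ∷ [])) $
       split 11 5 (occurs c₄ (0 ∷ 5 ∷ 11 ∷ 10 ∷ [])) $
       split 11 9 (occurs c₄ (4 ∷ 9 ∷ 11 ∷ 10 ∷ [])) $
       split 11 2
         (split 11 6 (occurs c₄ (1 ∷ 2 ∷ 11 ∷ 6 ∷ [])) $
          occurs c₇ (1 ∷ 2 ∷ 11 ∷ 10 ∷ 4 ∷ 9 ∷ 6 ∷ [])) $
       split 11 6 (occurs c₇ (1 ∷ 2 ∷ 3 ∷ 4 ∷ 10 ∷ 11 ∷ 6 ∷ [])) $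
       occurs p₇ (2 ∷ 1 ∷ 6 ∷ 9 ∷ 4 ∷ 10 ∷ 11 ∷ [])) $
    split 10 5
      (extend 10 0 0 $
       split 11 1 (occurs c₄ (0 ∷ 1 ∷ 11 ∷ 10 ∷ [])) $
       split 11 4 (occurs c₄ (0 ∷ 4 ∷ 11 ∷ 10 ∷ [])) $
       split 11 5 (occurs d (5 ∷ 10 ∷ 0 ∷ 11 ∷ [])) $
       split 11 7 (occurs c₄ (5 ∷ 7 ∷ 11 ∷ 10 ∷ [])) $
       split 11 8 (occurs c₄ (5 ∷ 8 ∷ 11 ∷ 10 ∷ [])) $
       split 11 2
         (split 11 6 (occurs c₄ (1 ∷ 2 ∷ 11 ∷ 6 ∷ [])) $
          occurs c₇ (1 ∷ 2 ∷ 11 ∷ 10 ∷ 5 ∷ 8 ∷ 6 ∷ [])) $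
       split 11 6 (occurs c₇ (1 ∷ 2 ∷ 7 ∷ 5 ∷ 10 ∷ 11 ∷ 6 ∷ [])) $
       occurs p₇ (2 ∷ 1 ∷ 6 ∷ 8 ∷ 5 ∷ 10 ∷ 11 ∷ [])) $
    extend 10 0 0 $
    split 11 1 (occurs c₄ (0 ∷ 1 ∷ 11 ∷ 10 ∷ [])) $
    split 11 4 (occurs c₄ (0 ∷ 4 ∷ 11 ∷ 10 ∷ [])) $
    split 11 5 (occurs c₄ (0 ∷ 5 ∷ 11 ∷ 10 ∷ [])) $
    split 11 2
      (split 11 6 (occurs c₄ (1 ∷ 2 ∷ 11 ∷ 6 ∷ [])) $
       split 11 8
         (split 11 3 (occurs d (3 ∷ 11 ∷ 2 ∷ 8 ∷ [])) $
          occurs c₄ (2 ∷ 3 ∷ 8 ∷ 11 ∷ []))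
         (occurs p₇ (2 ∷ 11 ∷ 10 ∷ 0 ∷ 5 ∷ 8 ∷ 6 ∷ []))) $
    split 11 8
      (split 11 7 (occurs c₄ (5 ∷ 7 ∷ 11 ∷ 8 ∷ [])) $
       occurs p₇ (1 ∷ 2 ∷ 7 ∷ 5 ∷ 8 ∷ 11 ∷ 10 ∷ [])) $
    split 11 3
      (split 11 6 (occurs c₄ (3 ∷ 8 ∷ 6 ∷ 11 ∷ [])) $
       occurs c₇ (0 ∷ 1 ∷ 6 ∷ 8 ∷ 3 ∷ 11 ∷ 10 ∷ []))
      (occurs p₇ (2 ∷ 3 ∷ 8 ∷ 5 ∷ 0 ∷ 10 ∷ 11 ∷ []))

-- Symmetry of the Petersen graph

automorphisms : Vec (Vec (Fin 10) 10) 10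
automorphisms =
  ((0F ∷ 1F ∷ 2F ∷ 3F ∷ 4F ∷ 5F ∷ 6F ∷ 7F ∷ 8F ∷ 9F ∷ []) ∷
   (1F ∷ 0F ∷ 4F ∷ 3F ∷ 2F ∷ 6F ∷ 5F ∷ 9F ∷ 8F ∷ 7F ∷ []) ∷
   (2F ∷ 1F ∷ 0F ∷ 4F ∷ 3F ∷ 7F ∷ 6F ∷ 5F ∷ 9F ∷ 8F ∷ []) ∷
   (3F ∷ 2F ∷ 1F ∷ 0F ∷ 4F ∷ 8F ∷ 7F ∷ 6F ∷ 5F ∷ 9F ∷ []) ∷
   (4F ∷ 0F ∷ 1F ∷ 2F ∷ 3F ∷ 9F ∷ 5F ∷ 6F ∷ 7F ∷ 8F ∷ []) ∷
   (5F ∷ 0F ∷ 1F ∷ 2F ∷ 7F ∷ 8F ∷ 4F ∷ 6F ∷ 3F ∷ 9F ∷ []) ∷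
   (6F ∷ 1F ∷ 0F ∷ 4F ∷ 9F ∷ 8F ∷ 2F ∷ 5F ∷ 3F ∷ 7F ∷ []) ∷
   (7F ∷ 2F ∷ 1F ∷ 0F ∷ 5F ∷ 9F ∷ 3F ∷ 6F ∷ 4F ∷ 8F ∷ []) ∷
   (8F ∷ 3F ∷ 2F ∷ 1F ∷ 6F ∷ 5F ∷ 4F ∷ 7F ∷ 0F ∷ 9F ∷ []) ∷
   (9F ∷ 4F ∷ 0F ∷ 1F ∷ 6F ∷ 7F ∷ 3F ∷ 5F ∷ 2F ∷ 8F ∷ []) ∷ [])

-- Row `i` of `automorphisms` sends 0 to `i`, and evaluation over all pairs verifies each row. Hence
-- the single case tree for a contact at 0 covers all ten vertices.
petersen-transitive : ∀ i → Σ[ σ ∈ Contains petersen petersen ] to σ zero ≡ i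
petersen-transitive i =
  let inj , agree , at-zero = check i in
  record { to        = lookup (lookup automorphisms i)
         ; injective = λ {j} {k} → inj j k
         ; embeds    = agreeing⇒embeds petersen petersen agree } ,
  at-zero
  where
  open Graph petersen
  check : ∀ i → let σ = lookup (lookup automorphisms i) in
          (∀ j k → σ j ≡ σ k → j ≡ k) × (∀ j k → does (j ~? k) ≡ does (σ j ~? σ k)) × σ zero ≡ i
  check = from-yes (Fin.all? λ i → let σ = lookup (lookup automorphisms i) in
    Fin.all? (λ j → Fin.all? λ k → (σ j Fin.≟ σ k) →-dec (j Fin.≟ k)) ×-dec
    Fin.all? (λ j → Fin.all? λ k → does (j ~? k) Bool.≟ does (σ j ~? σ k)) ×-dec
    (σ zero Fin.≟ i))

module _ {n} (G : Graph n) (expanding : Expanding G)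
  (p₇ : ¬ Contains (P 7) G) (c₇ : ¬ Contains (C 7) G)
  (c₄ : ¬ Contains (C 4) G) (d : ¬ Contains diamond G)
  where

  open Graph G

  -- Precomposing `h` with an automorphism moves the contact to 0, where `derive-pendant` applies
  -- with ⊥ for `A`.
  petersen-isolated : (h : Contains petersen G) → ∀ {z} → (∀ i → to h i ≢ z) →
                      ∀ i → ¬ (to h i ~ z)
  petersen-isolated h {z} z∉h i hi~z =
    let σ , σ₀≡i = petersen-transitive i in
    Derivations.derive-pendant G expanding p₇ c₇ c₄ d
      (proj₂ (realises-pendant G (Contains-trans σ h) (z∉h ∘ to σ) zero
        (subst (λ j → to h j ~ z) (sym σ₀≡i) hi~z)))

-- From an isolated copy to an isomorphism

module _ {n} (G : Graph n) where

  open Graph G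

  -- Isolation makes the image of `h` closed under adjacency; it contains the image of `zero`, so
  -- connectivity makes it all of `G` and `h` is a bijection.
  isolated⇒≅ : ∀ {m} {H : Graph (suc m)} → Connected G → (h : Contains H G) →
               (∀ {z} → (∀ i → to h i ≢ z) → ∀ i → ¬ (to h i ~ z)) → G ≅ H
  isolated⇒≅ {H = H} (_ , joined) h isolated =
    mk↔ₛ′ index (to h) (λ i → injective h (to-index (to h i))) to-index ,
    λ u v → mk⇔
      (λ u~v → Equivalence.from (embeds h _ _)
        (subst₂ _~_ (sym (to-index u)) (sym (to-index v)) u~v))
      (λ i~j → subst₂ _~_ (to-index u) (to-index v) (Equivalence.to (embeds h _ _) i~j))
    where
    Image : Fin n → Set
    Image v = ∃[ i ] to h i ≡ v

    image? : ∀ v → Dec (Image v)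
    image? v = Fin.any? λ i → to h i Fin.≟ v

    closed : ∀ {u v} → Image u → u ~ v → Image v
    closed {v = v} (i , refl) i~v with image? v
    ... | yes v∈ = v∈
    ... | no  v∉ = contradiction i~v (isolated (λ j eq → v∉ (j , eq)) i)

    reached : ∀ {u v} → Image u → Joined G ⊤ u v → Image v
    reached u∈ ε                     = u∈
    reached u∈ ((_ , _ , u~w) ◅ w~v) = reached (closed u∈ u~w) w~v

    image : ∀ v → Image v
    image v = reached (zero , refl) (joined (to h zero) v)

    index    = proj₁ ∘ image
    to-index = proj₂ ∘ image

-- Decidable subsets, cardinalities and maxima

module _ {n} {P : Fin n → Set} (P? : Decidable P) where

  ⟪_⟫ : Subset n
  ⟪_⟫ = tabulate (does ∘ P?)

  ∈⟪⟫⁺ : ∀ {v} → P v → v ∈ ⟪_⟫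
  ∈⟪⟫⁺ {v} p = Vec.lookup⇒[]= v _ (trans (Vec.lookup∘tabulate _ v) (dec-true (P? v) p))

  ∈⟪⟫⁻ : ∀ {v} → v ∈ ⟪_⟫ → P v
  ∈⟪⟫⁻ {v} v∈ = does-true (P? v) (trans (sym (Vec.lookup∘tabulate _ v)) (Vec.[]=⇒lookup v∈))

∣p∣≤1+∣p-x∣ : ∀ {n} (p : Subset n) x → ∣ p ∣ ≤ suc ∣ p - x ∣
∣p∣≤1+∣p-x∣ (inside  ∷ p) zero    = s≤s (ℕ.≤-reflexive (cong ∣_∣ (sym (Subset.p─⊥≡p p))))
∣p∣≤1+∣p-x∣ (outside ∷ p) zero    = ℕ.m≤n⇒m≤1+n (ℕ.≤-reflexive (cong ∣_∣ (sym (Subset.p─⊥≡p p))))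
∣p∣≤1+∣p-x∣ (inside  ∷ p) (suc x) = s≤s (∣p∣≤1+∣p-x∣ p x)
∣p∣≤1+∣p-x∣ (outside ∷ p) (suc x) = ∣p∣≤1+∣p-x∣ p x

x∉p-x : ∀ {n} (p : Subset n) x → ¬ (x ∈ p - x)
x∉p-x (_ ∷ p) (suc x) (there x∈) = x∉p-x p x x∈

-- Descends from the bound `m`: a failed test at `suc m` lowers the bound, and `P 0` settles the
-- bottom.
largest : {P : ℕ → Set} → Decidable P → P 0 → ∀ m → (∀ k → P k → k ≤ m) →
          ∃[ w ] P w × (∀ k → P k → k ≤ w)
largest P? p₀ zero    bound = 0 , p₀ , bound
largest P? p₀ (suc m) bound with P? (suc m)
... | yes p = suc m , p , bound
... | no ¬p = largest P? p₀ m λ k pk →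
  s≤s⁻¹ (ℕ.≤∧≢⇒< (bound k pk) λ { refl → ¬p pk })

-- Clique number, and expansion from large degrees

module _ {n} (G : Graph n) where

  open Graph G

  isClique? : Decidable (IsClique G)
  isClique? K = map′ (λ cl {u} {v} → cl u v) (λ cl u v → cl {u} {v}) $
    Fin.all? λ u → Fin.all? λ v →
      (u Subset.∈? K) →-dec (v Subset.∈? K) →-dec ¬? (u Fin.≟ v) →-dec (u ~? v)

  cliqueNumber : ∃[ w ] IsCliqueNumber G w
  cliqueNumber with largest
    (λ w → Subset.anySubset? λ K → isClique? K ×-dec (∣ K ∣ ℕ.≟ w))
    (Subset.⊥ , (λ u∈⊥ → contradiction u∈⊥ Subset.∉⊥) , Subset.∣⊥∣≡0 n) n
    (λ { _ (K , _ , refl) → Subset.∣p∣≤n K })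
  ... | w , clique , max = w , clique , λ K cl → max ∣ K ∣ (K , cl , refl)

  ~⇒≢ : ∀ {u v} → u ~ v → u ≢ v
  ~⇒≢ u~u refl = ~-irrefl u~u

  -- Otherwise `x`, `y`, `u`, `v` in this order induce the diamond, whose missing edge joins 2 and
  -- 3.
  diamond-closed : ¬ Contains diamond G → ∀ {x y u v} →
    x ~ y → x ~ u → y ~ u → x ~ v → y ~ v → u ≢ v → u ~ v
  diamond-closed d {x} {y} {u} {v} x~y x~u y~u x~v y~v u≢v =
    decidable-stable (u ~? v) λ u≁v → d $
    realises-occurs G (0 ∷ 1 ∷ 2 ∷ 3 ∷ [])
      (adjacent 0 1 x~y $ adjacent 0 2 x~u $ adjacent 1 2 y~u $
       adjacent 0 3 x~v $ adjacent 1 3 y~v $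
       realises-assume G 2 3 all-apart (dec-false (u ~? v) u≁v))
    where
    adjacent : ∀ {ρ c} i j → ρ i ~ ρ j → _Realises_ G ρ c → _Realises_ G ρ (assume i j true c)
    adjacent {ρ} i j e r = realises-assume G i j r (dec-true (ρ i ~? ρ j) e)

    all-apart =
      realises-fresh G {z = v}
        (realises-fresh G {z = u}
          (realises-fresh G {z = y}
            -- Any `ρ` realises the empty configuration; the constant `x` serves as the starting
            -- one.
            (realises-fresh G {λ _ → x} {config 0 λ _ _ → nothing} {x}
              (record { distinct = λ () ; agrees = λ () }) λ ())
            λ { {0} _ → ~⇒≢ x~y ; {suc _} (s≤s ()) })
          λ { {0} _ → ~⇒≢ x~u ; {1} _ → ~⇒≢ y~u ; {suc (suc _)} (s≤s (s≤s ())) })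
        λ { {0} _ → ~⇒≢ x~v ; {1} _ → ~⇒≢ y~v ; {2} _ → u≢v
          ; {suc (suc (suc _))} (s≤s (s≤s (s≤s ()))) }

  -- If no such vertex exists, every neighbour of `x` other than `w` lies in N[y], hence in the
  -- clique `K`, which forces the degree of `x` down to at most ω.
  expanding : ¬ Contains diamond G → ∀ {w} → IsCliqueNumber G w → (∀ v → w < degree G v) →
              Expanding G
  expanding d {ω} (_ , bound) large x y w x~y
    with Fin.any? (λ z → x ~? z ×-dec ¬? (y ~? z) ×-dec ¬? (z Fin.≟ y) ×-dec ¬? (z Fin.≟ w))
  ... | yes found = found
  ... | no  none  = contradiction (large x) (ℕ.≤⇒≯ degree≤ω)
    where
    Near : Fin n → Set
    Near u = u ≡ x ⊎ x ~ u × (u ≡ y ⊎ y ~ u)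

    near? : ∀ u → Dec (Near u)
    near? u = u Fin.≟ x ⊎-dec x ~? u ×-dec (u Fin.≟ y ⊎-dec y ~? u)

    K = ⟪ near? ⟫

    near-adjacent : ∀ {u v} → Near u → Near v → u ≢ v → u ~ v
    near-adjacent (inj₁ refl) (inj₁ refl) u≢v = contradiction refl u≢v
    near-adjacent (inj₁ refl) (inj₂ (x~v , _)) _ = x~v
    near-adjacent (inj₂ (x~u , _)) (inj₁ refl) _ = ~-sym x~u
    near-adjacent (inj₂ (_ , inj₁ refl)) (inj₂ (_ , inj₁ refl)) u≢v = contradiction refl u≢v
    near-adjacent (inj₂ (_ , inj₁ refl)) (inj₂ (_ , inj₂ y~v)) _ = y~v
    near-adjacent (inj₂ (_ , inj₂ y~u)) (inj₂ (_ , inj₁ refl)) _ = ~-sym y~u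
    near-adjacent (inj₂ (x~u , inj₂ y~u)) (inj₂ (x~v , inj₂ y~v)) =
      diamond-closed d x~y x~u y~u x~v y~v

    neighbours⊆K : neighbours G x - w Subset.⊆ K - x
    neighbours⊆K {u} u∈ =
      Subset.x∈p∧x≢y⇒x∈p-y (∈⟪⟫⁺ near? (inj₂ (x~u , y-near))) (≢-sym (~⇒≢ x~u))
      where
      x~u : x ~ u
      -- `neighbours G x` is by definition `⟪ x ~?_ ⟫`.
      x~u = ∈⟪⟫⁻ (x ~?_) (Subset.p─q⊆p _ _ u∈)

      u≢w : u ≢ w
      u≢w refl = x∉p-x _ w u∈

      y-near : u ≡ y ⊎ y ~ u
      y-near = decidable-stable (u Fin.≟ y ⊎-dec y ~? u) λ far →
        none (u , x~u , far ∘ inj₂ , far ∘ inj₁ , u≢w)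

    isClique : IsClique G K
    isClique u∈ v∈ = near-adjacent (∈⟪⟫⁻ near? u∈) (∈⟪⟫⁻ near? v∈)

    degree≤ω : degree G x ≤ ω
    -- Discarding `w` costs at most one, and `x`, which is in `K` but is not its own neighbour,
    -- makes up for it.
    degree≤ω = begin
      ∣ neighbours G x ∣         ≤⟨ ∣p∣≤1+∣p-x∣ (neighbours G x) w ⟩
      suc ∣ neighbours G x - w ∣ ≤⟨ s≤s (Subset.p⊆q⇒∣p∣≤∣q∣ neighbours⊆K) ⟩
      suc ∣ K - x ∣              ≤⟨ Subset.x∈p⇒∣p-x∣<∣p∣ (∈⟪⟫⁺ near? (inj₁ refl)) ⟩
      ∣ K ∣                      ≤⟨ bound K isClique ⟩
      ω                          ∎
      where open ℕ.≤-Reasoning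

-- A first edge, and the conclusion

edge-contained : ∀ {n} (G : Graph n) → let open Graph G in ∀ {u v} → u ~ v → Contains (P 2) G
edge-contained G {u} {v} u~v = record
  { to        = ρ
  ; injective = λ { {zero} {zero} _ → refl ; {zero} {suc zero} eq → contradiction eq (~⇒≢ G u~v)
                  ; {suc zero} {zero} eq → contradiction (sym eq) (~⇒≢ G u~v)
                  ; {suc zero} {suc zero} _ → refl }
  ; embeds    = agreeing⇒embeds (P 2) G λ
    { zero zero → sym (dec-false (u ~? u) ~-irrefl)
    ; zero (suc zero) → sym (dec-true (u ~? v) u~v)
    ; (suc zero) zero → sym (dec-true (v ~? u) (~-sym u~v))
    ; (suc zero) (suc zero) → sym (dec-false (v ~? v) ~-irrefl) }
  }
  where
  open Graph G
  ρ : Fin 2 → Fin _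
  ρ = lookup (u ∷ v ∷ [])

module _ {n} (G : Graph n) where
  open Graph G

  neighbour : ∀ v → 0 < degree G v → ∃[ u ] v ~ u
  neighbour v 0<deg with Fin.any? (v ~?_)
  ... | yes found = found
  ... | no  none  = contradiction (sym (trans (cong ∣_∣ N≡⊥) (Subset.∣⊥∣≡0 n))) (ℕ.<⇒≢ 0<deg)
    where
    N≡⊥ : neighbours G v ≡ Subset.⊥
    N≡⊥ = Subset.Empty-unique λ (u , u∈) → none (u , ∈⟪⟫⁻ (v ~?_) u∈)

theorem5p3 : ∀ {n : ℕ} (G : Graph n) → Connected G →
    (P 7 -Free) G → (C 7 -Free) G → (C 4 -Free) G → (diamond -Free) G →
    (G ≅ petersen)
    ⊎ (∃[ K ] IsCliqueCutset G K)
    ⊎ (∃[ v ] ∃[ w ] IsCliqueNumber G w × degree G v ≤ w)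
theorem5p3 {zero} G (() , _)
theorem5p3 {suc _} G connected p₇-free c₇-free c₄-free diamond-free
  with cliqueNumber G
... | ω , isω with Fin.any? (λ v → degree G v ≤? ω)
-- A vertex of degree at most ω is the third alternative; otherwise all degrees exceed ω and `G` is
-- shown to be the Petersen graph.
...   | yes (v , small) = inj₂ (inj₂ (v , ω , isω , small))
...   | no  none        =
  inj₁ (isolated⇒≅ G connected h (petersen-isolated G expands p₇ c₇ c₄ d h))
  where
  p₇ = ¬Contains {G = G} p₇-free
  c₇ = ¬Contains {G = G} c₇-free
  c₄ = ¬Contains {G = G} c₄-free
  d  = ¬Contains {G = G} diamond-free

  large : ∀ v → ω < degree G v
  large v = ℕ.≰⇒> λ small → none (v , small)

  expands : Expanding G
  expands = expanding G d isω large

  open Derivations G expands (⊥-elim ∘ p₇) (⊥-elim ∘ c₇) (⊥-elim ∘ c₄) (⊥-elim ∘ d)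

  c₆⇒petersen : Contains (C 6) G → Contains petersen G
  c₆⇒petersen = derive-C₆ id

  h : Contains petersen G
  h = derive-edge (derive-C₅ c₆⇒petersen) c₆⇒petersen
    -- The degree of vertex 0 exceeds ω and is therefore positive, which yields the edge to grow
    -- from.
    (edge-contained G (proj₂ (neighbour G zero (ℕ.≤-<-trans z≤n (large zero)))))
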